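{- For each integer $n \geq 1$ there exists a set $S_n \subset C_n(1)$ of cardinality $n+2$ which cannot be covered by fewer than $3$ parallel hyperplanes.
   Context: $C_n(1) = \{ \boldsymbol{x} \in \mathbb{Z}^n : |\boldsymbol{x}| \leq 1 \}$, where $|\boldsymbol{x}| = \max_i |x_i|$ is the sup-norm; thus $C_n(1) = \{0, \pm 1\}^n$. A hyperplane in $\mathbb{R}^n$ is an affine subspace of dimension $n-1$; "cannot be covered by fewer than $N$ parallel hyperplanes" means that no collection of fewer than $N$ pairwise parallel hyperplanes in $\mathbb{R}^n$ has union containing the set. -}

module Defs where

open import Algebra.Bundles using (CommutativeRing)
import Algebra.Properties.CommutativeSemigroup
import Algebra.Properties.Ring
import Algebra.Properties.Semiring.Sum
open import Data.Integer.Base as ℤ using (ℤ)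
open import Data.List.Base using (List)
open import Data.List.Membership.Propositional using (_∈_)
open import Data.Nat.Base as ℕ using (ℕ; _∸_)
import Data.Nat.Properties as ℕₚ
open import Data.Product.Base using (Σ; ∃; _×_; _,_; proj₁; proj₂)
open import Data.Rational.Base as ℚ using (ℚ; 0ℚ; 1ℚ)
import Data.Rational.Properties as ℚₚ
open import Data.Vec.Base as Vec using (Vec)
open import Data.Vec.Functional using (Vector; replicate; map; zipWith)
open import Data.Vec.Functional.Relation.Binary.Pointwise using (Pointwise)
open import Function.Base using (_∘_)
open import Level using (0ℓ)
open import Relation.Binary.PropositionalEquality
  using (_≡_; refl; sym; trans; cong; cong₂; subst; module ≡-Reasoning)
open import Relation.Unary as Pred using (Pred; _≐_)

------------------------------------------------------------------------
-- The real numbers, as Cauchy sequences of rationals modulo null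
-- sequences.

module Reals where

  -- f tends to 0 along the decreasing family of tails T.
  Vanishes : {I : Set} → (ℕ → Pred I 0ℓ) → (I → ℚ) → Set
  Vanishes T f = ∀ ε → 0ℚ ℚ.< ε → ∃ λ N → ∀ i → T N i → ℚ.∣ f i ∣ ℚ.< ε

  Tail : ℕ → Pred ℕ 0ℓ
  Tail N n = N ℕ.≤ n

  Tail₂ : ℕ → Pred (ℕ × ℕ) 0ℓ
  Tail₂ N (m , n) = N ℕ.≤ m × N ℕ.≤ n

  IsCauchy : (ℕ → ℚ) → Set
  IsCauchy x = Vanishes Tail₂ λ (m , n) → x m ℚ.- x n

  record ℝ : Set where
    constructor _,_
    field
      seq      : ℕ → ℚ
      isCauchy : IsCauchy seq
  open ℝ public

  infix 4 _≈_
  record _≈_ (x y : ℝ) : Set where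
    constructor mk≈
    field
      difference-vanishes : Vanishes Tail λ n → seq x n ℚ.- seq y n
  open _≈_ public

  private
    open ≡-Reasoning
    open Algebra.Properties.CommutativeSemigroup
      (CommutativeRing.+-commutativeSemigroup ℚₚ.+-*-commutativeRing) using (interchange)

    neg-involutive : ∀ a → ℚ.- (ℚ.- a) ≡ a
    neg-involutive = Algebra.Properties.Ring.-‿involutive (CommutativeRing.ring ℚₚ.+-*-commutativeRing)

    diff-cancel : ∀ a b → (a ℚ.- b) ℚ.+ b ≡ a
    diff-cancel a b = begin
      (a ℚ.- b) ℚ.+ b      ≡⟨ ℚₚ.+-assoc a (ℚ.- b) b ⟩
      a ℚ.+ (ℚ.- b ℚ.+ b)  ≡⟨ cong (a ℚ.+_) (ℚₚ.+-inverseˡ b) ⟩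
      a ℚ.+ 0ℚ             ≡⟨ ℚₚ.+-identityʳ a ⟩
      a                    ∎

    diff-+ : ∀ a b c d → (a ℚ.- b) ℚ.+ (c ℚ.- d) ≡ (a ℚ.+ c) ℚ.- (b ℚ.+ d)
    diff-+ a b c d = trans (interchange a (ℚ.- b) c (ℚ.- d))
      (cong ((a ℚ.+ c) ℚ.+_) (sym (ℚₚ.neg-distrib-+ b d)))

    diff-neg : ∀ a b → ℚ.- (a ℚ.- b) ≡ (ℚ.- a) ℚ.- (ℚ.- b)
    diff-neg a b = ℚₚ.neg-distrib-+ a (ℚ.- b)

    diff-sym : ∀ a b → ℚ.- (a ℚ.- b) ≡ b ℚ.- a
    diff-sym a b = begin
      ℚ.- (a ℚ.- b)              ≡⟨ diff-neg a b ⟩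
      ℚ.- a ℚ.+ (ℚ.- (ℚ.- b))    ≡⟨ cong (ℚ.- a ℚ.+_) (neg-involutive b) ⟩
      ℚ.- a ℚ.+ b                ≡⟨ ℚₚ.+-comm (ℚ.- a) b ⟩
      b ℚ.- a                    ∎

    diff-trans : ∀ a b c → (a ℚ.- b) ℚ.+ (b ℚ.- c) ≡ a ℚ.- c
    diff-trans a b c = begin
      (a ℚ.- b) ℚ.+ (b ℚ.- c)      ≡⟨ ℚₚ.+-assoc (a ℚ.- b) b (ℚ.- c) ⟨
      ((a ℚ.- b) ℚ.+ b) ℚ.- c      ≡⟨ cong (ℚ._- c) (diff-cancel a b) ⟩
      a ℚ.- c                      ∎

    *-diff : ∀ a b c → a ℚ.* (b ℚ.- c) ≡ a ℚ.* b ℚ.- a ℚ.* c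
    *-diff a b c = trans (ℚₚ.*-distribˡ-+ a b (ℚ.- c))
      (cong (a ℚ.* b ℚ.+_) (sym (ℚₚ.neg-distribʳ-* a c)))

    diff-* : ∀ a b c d → a ℚ.* (c ℚ.- d) ℚ.+ d ℚ.* (a ℚ.- b) ≡ a ℚ.* c ℚ.- b ℚ.* d
    diff-* a b c d = begin
      a ℚ.* (c ℚ.- d) ℚ.+ d ℚ.* (a ℚ.- b)
        ≡⟨ cong₂ ℚ._+_ (*-diff a c d) (*-diff d a b) ⟩
      (a ℚ.* c ℚ.- a ℚ.* d) ℚ.+ (d ℚ.* a ℚ.- d ℚ.* b)
        ≡⟨ cong₂ (λ p q → (a ℚ.* c ℚ.- a ℚ.* d) ℚ.+ (p ℚ.- q)) (ℚₚ.*-comm d a) (ℚₚ.*-comm d b) ⟩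
      (a ℚ.* c ℚ.- a ℚ.* d) ℚ.+ (a ℚ.* d ℚ.- b ℚ.* d)
        ≡⟨ diff-trans (a ℚ.* c) (a ℚ.* d) (b ℚ.* d) ⟩
      a ℚ.* c ℚ.- b ℚ.* d ∎

    half-pos : ∀ {ε} → 0ℚ ℚ.< ε → 0ℚ ℚ.< ℚ.½ ℚ.* ε
    half-pos {ε} 0<ε = subst (ℚ._< ℚ.½ ℚ.* ε) (ℚₚ.*-zeroʳ ℚ.½) (ℚₚ.*-monoʳ-<-pos ℚ.½ 0<ε)

    halves : ∀ ε → ℚ.½ ℚ.* ε ℚ.+ ℚ.½ ℚ.* ε ≡ ε
    halves ε = trans (sym (ℚₚ.*-distribʳ-+ ε ℚ.½ ℚ.½)) (ℚₚ.*-identityˡ ε)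

  module Vanishing {I : Set} (T : ℕ → Pred I 0ℓ)
                   (T-anti : ∀ {M N} → M ℕ.≤ N → T N Pred.⊆ T M) where

    cong-V : ∀ {f g} → (∀ i → f i ≡ g i) → Vanishes T f → Vanishes T g
    cong-V f≗g v ε 0<ε with v ε 0<ε
    ... | N , p = N , λ i t → subst (λ q → ℚ.∣ q ∣ ℚ.< ε) (f≗g i) (p i t)

    zero-V : Vanishes T (λ _ → 0ℚ)
    zero-V ε 0<ε = 0 , λ _ _ → 0<ε

    neg-V : ∀ {f} → Vanishes T f → Vanishes T (ℚ.-_ ∘ f)
    neg-V {f} v ε 0<ε with v ε 0<ε
    ... | N , p = N , λ i t → subst (ℚ._< ε) (sym (ℚₚ.∣-p∣≡∣p∣ (f i))) (p i t)

    add-V : ∀ {f g} → Vanishes T f → Vanishes T g → Vanishes T (λ i → f i ℚ.+ g i)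
    add-V {f} {g} u v ε 0<ε with u (ℚ.½ ℚ.* ε) (half-pos 0<ε) | v (ℚ.½ ℚ.* ε) (half-pos 0<ε)
    ... | M , p | N , q = M ℕ.⊔ N , λ i t →
      ℚₚ.≤-<-trans (ℚₚ.∣p+q∣≤∣p∣+∣q∣ (f i) (g i))
        (subst (ℚ.∣ f i ∣ ℚ.+ ℚ.∣ g i ∣ ℚ.<_) (halves ε)
          (ℚₚ.+-mono-< (p i (T-anti (ℕₚ.m≤m⊔n M N) t)) (q i (T-anti (ℕₚ.m≤n⊔m M N) t))))

    Bounded : (I → ℚ) → Set
    Bounded b = ∃ λ B → ℚ.Positive B × ∃ λ N → ∀ i → T N i → ℚ.∣ b i ∣ ℚ.≤ B

    mul-V : ∀ {b f} → Bounded b → Vanishes T f → Vanishes T (λ i → b i ℚ.* f i)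
    mul-V {b} {f} (B , B>0 , M , p) v ε 0<ε = M ℕ.⊔ N , λ i t →
        ℚₚ.≤-<-trans
          (subst (ℚ._≤ B ℚ.* ℚ.∣ f i ∣) (sym (ℚₚ.∣p*q∣≡∣p∣*∣q∣ (b i) (f i)))
            (ℚₚ.*-monoʳ-≤-nonNeg ℚ.∣ f i ∣ {{ℚₚ.∣-∣-nonNeg (f i)}}
              (p i (T-anti (ℕₚ.m≤m⊔n M N) t))))
          (subst (B ℚ.* ℚ.∣ f i ∣ ℚ.<_) Bδ≡ε
            (ℚₚ.*-monoʳ-<-pos B (q i (T-anti (ℕₚ.m≤n⊔m M N) t))))
      where
      instance
        B-pos : ℚ.Positive B
        B-pos = B>0
        B-nonZero : ℚ.NonZero B
        B-nonZero = ℚₚ.pos⇒nonZero B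
        1/B-pos : ℚ.Positive (ℚ.1/ B)
        1/B-pos = ℚₚ.1/pos⇒pos B

      δ : ℚ
      δ = ℚ.1/ B ℚ.* ε

      Bδ≡ε : B ℚ.* δ ≡ ε
      Bδ≡ε = trans (sym (ℚₚ.*-assoc B (ℚ.1/ B) ε))
               (trans (cong (ℚ._* ε) (ℚₚ.*-inverseʳ B)) (ℚₚ.*-identityˡ ε))

      0<δ : 0ℚ ℚ.< δ
      0<δ = subst (ℚ._< δ) (ℚₚ.*-zeroʳ (ℚ.1/ B)) (ℚₚ.*-monoʳ-<-pos (ℚ.1/ B) 0<ε)

      N = proj₁ (v δ 0<δ)
      q = proj₂ (v δ 0<δ)

  Tail-anti : ∀ {M N} → M ℕ.≤ N → Tail N Pred.⊆ Tail M
  Tail-anti M≤N p = ℕₚ.≤-trans M≤N p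

  Tail₂-anti : ∀ {M N} → M ℕ.≤ N → Tail₂ N Pred.⊆ Tail₂ M
  Tail₂-anti M≤N (p , q) = ℕₚ.≤-trans M≤N p , ℕₚ.≤-trans M≤N q

  module V₁ = Vanishing Tail Tail-anti
  module V₂ = Vanishing Tail₂ Tail₂-anti

  -- Opaque, so that comparing reals never unfolds the Cauchy proofs.
  abstract
    bounded : ∀ x → V₁.Bounded (seq x)
    bounded (x , c) with c 1ℚ (ℚₚ.positive⁻¹ 1ℚ)
    ... | N , p = 1ℚ ℚ.+ ℚ.∣ x N ∣
                , ℚₚ.pos+nonNeg⇒pos 1ℚ ℚ.∣ x N ∣ {{ℚₚ.∣-∣-nonNeg (x N)}}
                , N , λ n N≤n →
                  subst (ℚ._≤ 1ℚ ℚ.+ ℚ.∣ x N ∣) (cong ℚ.∣_∣ (diff-cancel (x n) (x N)))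
                    (ℚₚ.≤-trans (ℚₚ.∣p+q∣≤∣p∣+∣q∣ (x n ℚ.- x N) (x N))
                      (ℚₚ.+-monoˡ-≤ ℚ.∣ x N ∣ (ℚₚ.<⇒≤ (p (n , N) (N≤n , ℕₚ.≤-refl)))))

    bounded-fst : ∀ {x} → V₁.Bounded x → V₂.Bounded (x ∘ proj₁)
    bounded-fst (B , B>0 , N , p) = B , B>0 , N , λ (m , _) (N≤m , _) → p m N≤m

    bounded-snd : ∀ {x} → V₁.Bounded x → V₂.Bounded (x ∘ proj₂)
    bounded-snd (B , B>0 , N , p) = B , B>0 , N , λ (_ , n) (_ , N≤n) → p n N≤n

    const-isCauchy : ∀ q → IsCauchy (λ _ → q)
    const-isCauchy q = V₂.cong-V (λ _ → sym (ℚₚ.+-inverseʳ q)) V₂.zero-V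

    +-isCauchy : ∀ x y → IsCauchy (λ n → seq x n ℚ.+ seq y n)
    +-isCauchy (x , c) (y , d) =
      V₂.cong-V (λ (m , n) → diff-+ (x m) (x n) (y m) (y n)) (V₂.add-V c d)

    neg-isCauchy : ∀ x → IsCauchy (λ n → ℚ.- seq x n)
    neg-isCauchy (x , c) = V₂.cong-V (λ (m , n) → diff-neg (x m) (x n)) (V₂.neg-V c)

    *-isCauchy : ∀ x y → IsCauchy (λ n → seq x n ℚ.* seq y n)
    *-isCauchy (x , c) (y , d) =
      V₂.cong-V (λ (m , n) → diff-* (x m) (x n) (y m) (y n))
        (V₂.add-V (V₂.mul-V (bounded-fst (bounded (x , c))) d)
                  (V₂.mul-V (bounded-snd (bounded (y , d))) c))

  infixl 6 _+_
  infixl 7 _*_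
  infix  8 -_

  _+_ : ℝ → ℝ → ℝ
  x + y = (λ n → seq x n ℚ.+ seq y n) , +-isCauchy x y

  -_ : ℝ → ℝ
  - x = (λ n → ℚ.- seq x n) , neg-isCauchy x

  _*_ : ℝ → ℝ → ℝ
  x * y = (λ n → seq x n ℚ.* seq y n) , *-isCauchy x y

  fromℚ : ℚ → ℝ
  fromℚ q = (λ _ → q) , const-isCauchy q

  fromℤ : ℤ → ℝ
  fromℤ z = fromℚ (z ℚ./ 1)

  0ℝ 1ℝ : ℝ
  0ℝ = fromℚ 0ℚ
  1ℝ = fromℚ 1ℚ

  ≗⇒≈ : ∀ {x y} → (∀ n → seq x n ≡ seq y n) → x ≈ y
  ≗⇒≈ {x} {y} x≗y = mk≈ (V₁.cong-V
    (λ n → sym (trans (cong (ℚ._- seq y n) (x≗y n)) (ℚₚ.+-inverseʳ (seq y n)))) V₁.zero-V)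

  ≈-refl : ∀ {x} → x ≈ x
  ≈-refl = ≗⇒≈ λ _ → refl

  ≈-sym : ∀ {x y} → x ≈ y → y ≈ x
  ≈-sym {x} {y} (mk≈ p) =
    mk≈ (V₁.cong-V (λ n → diff-sym (seq x n) (seq y n)) (V₁.neg-V p))

  ≈-trans : ∀ {x y z} → x ≈ y → y ≈ z → x ≈ z
  ≈-trans {x} {y} {z} (mk≈ p) (mk≈ q) =
    mk≈ (V₁.cong-V (λ n → diff-trans (seq x n) (seq y n) (seq z n)) (V₁.add-V p q))

  +-cong : ∀ {x y u v} → x ≈ y → u ≈ v → x + u ≈ y + v
  +-cong {x} {y} {u} {v} (mk≈ p) (mk≈ q) =
    mk≈ (V₁.cong-V (λ n → diff-+ (seq x n) (seq y n) (seq u n) (seq v n)) (V₁.add-V p q))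

  -‿cong : ∀ {x y} → x ≈ y → - x ≈ - y
  -‿cong {x} {y} (mk≈ p) =
    mk≈ (V₁.cong-V (λ n → diff-neg (seq x n) (seq y n)) (V₁.neg-V p))

  *-cong : ∀ {x y u v} → x ≈ y → u ≈ v → x * u ≈ y * v
  *-cong {x} {y} {u} {v} (mk≈ p) (mk≈ q) =
    mk≈ (V₁.cong-V (λ n → diff-* (seq x n) (seq y n) (seq u n) (seq v n))
      (V₁.add-V (V₁.mul-V (bounded x) q) (V₁.mul-V (bounded v) p)))

  ℝ-commutativeRing : CommutativeRing 0ℓ 0ℓ
  ℝ-commutativeRing = record
    { Carrier = ℝ ; _≈_ = _≈_ ; _+_ = _+_ ; _*_ = _*_ ; -_ = -_ ; 0# = 0ℝ ; 1# = 1ℝ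
    ; isCommutativeRing = record
      { isRing = record
        { +-isAbelianGroup = record
          { isGroup = record
            { isMonoid = record
              { isSemigroup = record
                { isMagma = record
                  { isEquivalence = record { refl = ≈-refl ; sym = ≈-sym ; trans = ≈-trans }
                  ; ∙-cong = +-cong }
                ; assoc = λ x y z → ≗⇒≈ λ n → ℚₚ.+-assoc (seq x n) (seq y n) (seq z n) }
              ; identity = (λ x → ≗⇒≈ λ n → ℚₚ.+-identityˡ (seq x n))
                         , (λ x → ≗⇒≈ λ n → ℚₚ.+-identityʳ (seq x n)) }
            ; inverse = (λ x → ≗⇒≈ λ n → ℚₚ.+-inverseˡ (seq x n))
                      , (λ x → ≗⇒≈ λ n → ℚₚ.+-inverseʳ (seq x n))
            ; ⁻¹-cong = -‿cong }
          ; comm = λ x y → ≗⇒≈ λ n → ℚₚ.+-comm (seq x n) (seq y n) }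
        ; *-cong = *-cong
        ; *-assoc = λ x y z → ≗⇒≈ λ n → ℚₚ.*-assoc (seq x n) (seq y n) (seq z n)
        ; *-identity = (λ x → ≗⇒≈ λ n → ℚₚ.*-identityˡ (seq x n))
                     , (λ x → ≗⇒≈ λ n → ℚₚ.*-identityʳ (seq x n))
        ; distrib = (λ x y z → ≗⇒≈ λ n → ℚₚ.*-distribˡ-+ (seq x n) (seq y n) (seq z n))
                  , (λ x y z → ≗⇒≈ λ n → ℚₚ.*-distribʳ-+ (seq x n) (seq y n) (seq z n)) }
      ; *-comm = λ x y → ≗⇒≈ λ n → ℚₚ.*-comm (seq x n) (seq y n) } }

open Reals using (ℝ; 0ℝ; fromℤ; ℝ-commutativeRing)
open CommutativeRing ℝ-commutativeRing using (semiring)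
open Algebra.Properties.Semiring.Sum semiring using (sum)

------------------------------------------------------------------------
-- Linear and affine geometry of ℝⁿ

ℝ^ : ℕ → Set
ℝ^ = Vector ℝ

infix  4 _≋_
infixl 6 _+ᵛ_ _-ᵛ_
infixr 7 _·_

_≋_ : ∀ {n} → ℝ^ n → ℝ^ n → Set
_≋_ = Pointwise Reals._≈_

0ᵛ : ∀ {n} → ℝ^ n
0ᵛ = replicate _ 0ℝ

_+ᵛ_ _-ᵛ_ : ∀ {n} → ℝ^ n → ℝ^ n → ℝ^ n
_+ᵛ_ = zipWith Reals._+_
x -ᵛ y = x +ᵛ map Reals.-_ y

_·_ : ∀ {n} → ℝ → ℝ^ n → ℝ^ n
t · x = map (t Reals.*_) x

linComb : ∀ {n d} → Vector ℝ d → Vector (ℝ^ n) d → ℝ^ n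
linComb t v j = sum λ i → t i Reals.* v i j

record Subspace (n : ℕ) : Set₁ where
  field
    Carrier  : Pred (ℝ^ n) 0ℓ
    resp     : ∀ {x y} → x ≋ y → Carrier x → Carrier y
    0-closed : Carrier 0ᵛ
    +-closed : ∀ {x y} → Carrier x → Carrier y → Carrier (x +ᵛ y)
    ·-closed : ∀ t {x} → Carrier x → Carrier (t · x)

LinearlyIndependent : ∀ {n d} → Vector (ℝ^ n) d → Set
LinearlyIndependent v = ∀ t → linComb t v ≋ 0ᵛ → t ≋ 0ᵛ

record IsBasis {n d} (V : Subspace n) (v : Vector (ℝ^ n) d) : Set where
  open Subspace V
  field
    members     : ∀ i → Carrier (v i)
    independent : LinearlyIndependent v
    spanning    : ∀ {x} → Carrier x → ∃ λ t → x ≋ linComb t v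

HasDimension : ∀ {n} → Subspace n → ℕ → Set
HasDimension {n} V d = Σ (Vector (ℝ^ n) d) (IsBasis V)

record AffineSubspace (n : ℕ) : Set₁ where
  field
    point     : ℝ^ n
    direction : Subspace n

infix 4 _∈ᴬ_
_∈ᴬ_ : ∀ {n} → ℝ^ n → AffineSubspace n → Set
x ∈ᴬ A = Subspace.Carrier direction (x -ᵛ point)
  where open AffineSubspace A

-- Only meaningful for n ≥ 1, because of the truncated subtraction.
record Hyperplane (n : ℕ) : Set₁ where
  field
    affine    : AffineSubspace n
    dimension : HasDimension (AffineSubspace.direction affine) (n ∸ 1)
  open AffineSubspace affine public

-- A hyperplane is parallel to itself.
Parallel : ∀ {n} → Hyperplane n → Hyperplane n → Set
Parallel H K =
  Subspace.Carrier (Hyperplane.direction H) ≐ Subspace.Carrier (Hyperplane.direction K)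

------------------------------------------------------------------------
-- Integer points

supNorm : ∀ {n} → Vec ℤ n → ℕ
supNorm = Vec.foldr′ ℕ._⊔_ 0 ∘ Vec.map ℤ.∣_∣

C : (n h : ℕ) → Pred (Vec ℤ n) 0ℓ
C n h x = supNorm x ℕ.≤ h

toℝ^ : ∀ {n} → Vec ℤ n → ℝ^ n
toℝ^ = map fromℤ ∘ Vec.lookup

-- The family H may repeat a hyperplane, so k bounds the number of distinct
-- ones; this gives the same notion as a set of fewer than N hyperplanes.
CoveredByFewerParallelHyperplanes : ∀ {n} → ℕ → List (Vec ℤ n) → Set₁
CoveredByFewerParallelHyperplanes {n} N S =
  ∃ λ k → k ℕ.< N × Σ (Vector (Hyperplane n) k) λ H →
    (∀ i j → Parallel (H i) (H j)) ×
    (∀ {x} → x ∈ S → ∃ λ i → toℝ^ x ∈ᴬ Hyperplane.affine (H i))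

{-# OPTIONS --safe #-}

-- Take S = {0, -(e₁ + … + eₙ), e₁, …, eₙ}. Suppose two parallel hyperplanes
-- with common direction V cover S, and let w be the difference of their base
-- points, with sign such that every nonzero point of S lies in V or in w + V.
-- The nonzero points sum to 0, so if k of them lie in w + V then k w ∈ V. Either
-- way all of them lie in V, so V contains the standard basis, which is
-- impossible in dimension n - 1.
--
-- Equality of Cauchy reals is undecidable, so the last step is not Gaussian
-- elimination with division: it is proved over any reduced commutative ring.
module Submission where

open import Defs
open import Algebra.Bundles using (CommutativeRing)
import Algebra.Properties.Semiring.Sum
open import Data.Fin.Base using (Fin; zero; suc; punchIn)
open import Data.Fin.Properties using (punchInᵢ≢i; suc-injective; _≟_)
open import Data.Integer.Base as ℤ using (ℤ; 0ℤ; 1ℤ; -1ℤ)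
open import Data.List.Base using (List; length; tabulate)
open import Data.List.Membership.Propositional.Properties using (∈-tabulate⁺)
open import Data.List.Properties using (length-tabulate)
open import Data.List.Relation.Unary.All using (All)
import Data.List.Relation.Unary.All.Properties as All
open import Data.List.Relation.Unary.Unique.Propositional using (Unique)
import Data.List.Relation.Unary.Unique.Propositional.Properties as Unique
open import Data.Nat.Base as ℕ using (ℕ; suc; _+_; _≥_; _≤_; z≤n; s≤s)
import Data.Nat.Properties as ℕₚ
open import Data.Product.Base using (Σ; ∃; _×_; _,_; proj₁; proj₂)
open import Data.Rational.Base as ℚ using (ℚ; 0ℚ; 1ℚ)
import Data.Rational.Properties as ℚₚ
open import Data.Rational.Solver using (module +-*-Solver)
open import Data.Sum.Base as Sum using (_⊎_; inj₁; inj₂; [_,_]′)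
open import Data.Vec.Base as Vec using (Vec; []; _∷_; lookup; _[_]≔_)
open import Data.Vec.Functional using (Vector)
open import Data.Vec.Properties using (lookup-replicate; lookup∘update; lookup∘update′)
open import Function.Base using (_∘_; id)
open import Relation.Binary.PropositionalEquality as ≡
  using (_≡_; _≢_; cong; subst)
import Relation.Binary.Reasoning.Setoid
open import Relation.Nullary using (¬_; yes; no; contradiction)

-- Rank of scalar matrices over a reduced commutative ring.

Reduced : ∀ {c ℓ} → CommutativeRing c ℓ → Set _
Reduced R = ∀ x → x * x ≈ 0# → x ≈ 0#
  where open CommutativeRing R

module Rank {c ℓ} (R : CommutativeRing c ℓ) (reduced : Reduced R) where

  open CommutativeRing R hiding (zero) renaming (_+_ to infixl 6 _+ᴿ_)
  open Algebra.Properties.Semiring.Sum semiring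
  open Relation.Binary.Reasoning.Setoid setoid

  sum-zero : ∀ {n} {f : Vector Carrier n} → (∀ i → f i ≈ 0#) → sum f ≈ 0#
  sum-zero {n} f≈0 = trans (sum-cong-≋ f≈0) (sum-replicate-zero n)

  sum-linear : ∀ {n} a b (f g : Vector Carrier n) →
    sum (λ i → a * f i +ᴿ b * g i) ≈ a * sum f +ᴿ b * sum g
  sum-linear a b f g = begin
    sum (λ i → a * f i +ᴿ b * g i)                ≈⟨ ∑-distrib-+ (λ i → a * f i) (λ i → b * g i) ⟩
    sum (λ i → a * f i) +ᴿ sum (λ i → b * g i)    ≈⟨ +-cong (*-distribˡ-sum a f) (*-distribˡ-sum b g) ⟨
    a * sum f +ᴿ b * sum g                        ∎

  -- If T has a row t in excess, clearing its k-th column against t gives a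
  -- factorisation of (t k * s) I of smaller size, so t k * s ≈ 0 for all k;
  -- hence s * s, being a combination of these products, vanishes.
  scalar-matrix-rank : ∀ m {s} (T : Fin (suc m) → Fin m → Carrier)
    (B : Fin m → Fin (suc m) → Carrier) →
    (∀ i → sum (λ k → T i k * B k i) ≈ s) →
    (∀ {i j} → i ≢ j → sum (λ k → T i k * B k j) ≈ 0#) →
    s ≈ 0#
  -- The inner sum is empty here, so `diag zero` already reads `0# ≈ s`.
  scalar-matrix-rank ℕ.zero T B diag off = sym (diag zero)
  scalar-matrix-rank (suc m) {s} T B diag off = reduced s (begin
    s * s                                            ≈⟨ *-congˡ (diag zero) ⟨
    s * sum (λ k → T zero k * B k zero)              ≈⟨ *-distribˡ-sum s (λ k → T zero k * B k zero) ⟩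
    sum (λ k → s * (T zero k * B k zero))            ≈⟨ sum-zero term ⟩
    0#                                               ∎)
    where
    module Eliminate (k : Fin (suc m)) where
      t = T zero k

      -- Fraction-free elimination: the lower row is multiplied by `t`, since `t` need not be
      -- invertible.
      row : Fin (suc m) → Fin (suc m) → Carrier
      row i l = t * T (suc i) l +ᴿ - T (suc i) k * T zero l

      pivot : ∀ i → row i k ≈ 0#
      pivot i = begin
        t * T (suc i) k +ᴿ - T (suc i) k * t  ≈⟨ +-congʳ (*-comm _ _) ⟩
        T (suc i) k * t +ᴿ - T (suc i) k * t  ≈⟨ distribʳ _ _ _ ⟨
        (T (suc i) k +ᴿ - T (suc i) k) * t    ≈⟨ *-congʳ (-‿inverseʳ _) ⟩
        0# * t                                ≈⟨ zeroˡ t ⟩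
        0#                                    ∎

      product : ∀ i j → sum (λ l → row i (punchIn k l) * B (punchIn k l) (suc j))
                      ≈ t * sum (λ l → T (suc i) l * B l (suc j))
      product i j = begin
        sum (λ l → row i (punchIn k l) * B (punchIn k l) (suc j))
          -- Column `k` of `row` is zero by `pivot`, so its term can be put back; the sum then runs
          -- over all columns and splits linearly.
          ≈⟨ +-identityˡ _ ⟨
        0# +ᴿ sum (λ l → row i (punchIn k l) * B (punchIn k l) (suc j))
          ≈⟨ +-congʳ (trans (*-congʳ (pivot i)) (zeroˡ _)) ⟨
        row i k * B k (suc j) +ᴿ sum (λ l → row i (punchIn k l) * B (punchIn k l) (suc j))
          ≈⟨ sum-remove (λ l → row i l * B l (suc j)) ⟨
        sum (λ l → row i l * B l (suc j))
          ≈⟨ sum-cong-≋ {suc m} (λ l →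
               trans (distribʳ (B l (suc j)) (t * T (suc i) l) (- T (suc i) k * T zero l))
                     (+-cong (*-assoc t (T (suc i) l) (B l (suc j)))
                             (*-assoc (- T (suc i) k) (T zero l) (B l (suc j))))) ⟩
        sum (λ l → t * (T (suc i) l * B l (suc j)) +ᴿ - T (suc i) k * (T zero l * B l (suc j)))
          ≈⟨ sum-linear t (- T (suc i) k) (λ l → T (suc i) l * B l (suc j))
               (λ l → T zero l * B l (suc j)) ⟩
        t * sum (λ l → T (suc i) l * B l (suc j)) +ᴿ
          - T (suc i) k * sum (λ l → T zero l * B l (suc j))
          -- The second sum pairs row `zero` with column `suc j`, an off-diagonal entry.
          ≈⟨ +-congˡ (trans (*-congˡ (off λ ())) (zeroʳ _)) ⟩
        t * sum (λ l → T (suc i) l * B l (suc j)) +ᴿ 0#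
          ≈⟨ +-identityʳ _ ⟩
        t * sum (λ l → T (suc i) l * B l (suc j)) ∎

      vanishes : t * s ≈ 0#
      vanishes = scalar-matrix-rank m
        (λ i l → row i (punchIn k l)) (λ l j → B (punchIn k l) (suc j))
        (λ i → trans (product i i) (*-congˡ (diag (suc i))))
        (λ {i} {j} i≢j → trans (product i j)
          (trans (*-congˡ (off (i≢j ∘ suc-injective))) (zeroʳ t)))

    term : ∀ k → s * (T zero k * B k zero) ≈ 0#
    term k = begin
      s * (T zero k * B k zero)  ≈⟨ *-assoc _ _ _ ⟨
      s * T zero k * B k zero    ≈⟨ *-congʳ (trans (*-comm _ _) (Eliminate.vanishes k)) ⟩
      0# * B k zero              ≈⟨ zeroˡ _ ⟩
      0#                         ∎

-- The reals as a reduced nontrivial ring.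

open Reals using
  (0ℝ; 1ℝ; fromℚ; fromℤ; seq; _≈_; mk≈; ≗⇒≈; ≈-refl; ≈-sym; ≈-trans; ℝ-commutativeRing)
open CommutativeRing ℝ-commutativeRing using (semiring; setoid; +-cong; +-identityʳ)
open Algebra.Properties.Semiring.Sum semiring using (sum; sum-remove)

-- To get terms below `ε`, ask the squares to be below `ε ℚ.* ε`: a term with absolute value at
-- least `ε` would have too large a square. The comparison is between rationals, hence decidable.
ℝ-reduced : Reduced ℝ-commutativeRing
ℝ-reduced x (mk≈ x²→0) = mk≈ λ ε 0<ε →
  let instance ε-pos = ℚ.positive 0<ε
      N , p = x²→0 (ε ℚ.* ε) (ℚₚ.positive⁻¹ (ε ℚ.* ε) {{ℚₚ.pos*pos⇒pos ε ε}})
  in N , λ n N≤n → ℚₚ.≰⇒> λ ε≤∣x∣ → ℚₚ.<-irrefl ≡.refl (ℚₚ.≤-<-trans (square-≤ n ε≤∣x∣) (p n N≤n))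
  where
  square-≤ : ∀ {ε} {{_ : ℚ.Positive ε}} n → ε ℚ.≤ ℚ.∣ seq x n ℚ.- 0ℚ ∣ →
             ε ℚ.* ε ℚ.≤ ℚ.∣ seq x n ℚ.* seq x n ℚ.- 0ℚ ∣
  square-≤ {ε} n ε≤∣x∣ = begin
    ε ℚ.* ε                            ≤⟨ ℚₚ.*-monoˡ-≤-nonNeg ε {{ℚₚ.pos⇒nonNeg ε}} ε≤∣a∣ ⟩
    ε ℚ.* ℚ.∣ a ∣                      ≤⟨ ℚₚ.*-monoʳ-≤-nonNeg ℚ.∣ a ∣ {{ℚₚ.∣-∣-nonNeg a}} ε≤∣a∣ ⟩
    ℚ.∣ a ∣ ℚ.* ℚ.∣ a ∣                ≡⟨ ℚₚ.∣p*q∣≡∣p∣*∣q∣ a a ⟨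
    ℚ.∣ a ℚ.* a ∣                      ≡⟨ cong ℚ.∣_∣ (ℚₚ.+-identityʳ (a ℚ.* a)) ⟨
    ℚ.∣ a ℚ.* a ℚ.- 0ℚ ∣               ∎
    where
    open ℚₚ.≤-Reasoning
    a = seq x n
    ε≤∣a∣ = subst (λ b → ε ℚ.≤ ℚ.∣ b ∣) (ℚₚ.+-identityʳ a) ε≤∣x∣

1≉0 : ¬ 1ℝ ≈ 0ℝ
1≉0 (mk≈ v) with v 1ℚ (ℚₚ.positive⁻¹ 1ℚ)
... | N , p = ℚₚ.<-irrefl ≡.refl (p N ℕₚ.≤-refl)

open Rank ℝ-commutativeRing ℝ-reduced using (sum-zero; scalar-matrix-rank)

-- Standard bases and dimension.

∑ᵛ : ∀ {n d} → Vector (ℝ^ n) d → ℝ^ n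
∑ᵛ v j = sum λ i → v i j

IsStandardBasis : ∀ {n} → Vector (ℝ^ n) n → Set
IsStandardBasis e = (∀ i → e i i ≈ 1ℝ) × (∀ {i j} → i ≢ j → e i j ≈ 0ℝ)

-- Expanding each `e i` in the `m` vectors spanning `V` factors the identity matrix of size `suc m`
-- through size `m`; the rank lemma with scalar `1ℝ` then gives `1ℝ ≈ 0ℝ`.
standardBasis⊈ : ∀ {m} (V : Subspace (suc m)) → HasDimension V m →
  ∀ {e} → IsStandardBasis e → ¬ (∀ i → Subspace.Carrier V (e i))
standardBasis⊈ {m} V (v , basis) (e-diag , e-off) e∈V =
  1≉0 (scalar-matrix-rank m (λ i → proj₁ (spanning (e∈V i))) v
    (λ i → ≈-trans (≈-sym (proj₂ (spanning (e∈V i)) i)) (e-diag i))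
    (λ {i} {j} i≢j → ≈-trans (≈-sym (proj₂ (spanning (e∈V i)) j)) (e-off i≢j)))
  where open IsBasis basis

-- Vectors in a subspace and its translates.

module Cosets {n} (V : Subspace n) where
  open Subspace V
  open +-*-Solver

  ∑-closed : ∀ {d} {v : Vector (ℝ^ n) d} → (∀ i → Carrier (v i)) → Carrier (∑ᵛ v)
  ∑-closed {ℕ.zero} v∈V = 0-closed
  ∑-closed {suc d}  v∈V = +-closed (v∈V zero) (∑-closed (v∈V ∘ suc))

  -ᵛ-closed : ∀ {x y} → Carrier x → Carrier y → Carrier (x -ᵛ y)
  -ᵛ-closed {x} {y} x∈V y∈V = resp
    (λ j → ≗⇒≈ λ m → solve 2 (λ a b → a :+ con (ℚ.- 1ℚ) :* b := a :- b) ≡.refl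
      (seq (x j) m) (seq (y j) m))
    (+-closed x∈V (·-closed (fromℚ (ℚ.- 1ℚ)) y∈V))

  -- The scalar is a rational constant, so its inverse is taken in `ℚ` and no real number is ever
  -- inverted.
  ·-cancel : ∀ q .{{_ : ℚ.NonZero q}} {x} → Carrier (fromℚ q · x) → Carrier x
  ·-cancel q {x} qx∈V = resp
    (λ j → ≗⇒≈ λ m → ≡.trans (≡.sym (ℚₚ.*-assoc (ℚ.1/ q) q (seq (x j) m)))
      (≡.trans (cong (ℚ._* seq (x j) m) (ℚₚ.*-inverseˡ q)) (ℚₚ.*-identityˡ _)))
    (·-closed (fromℚ (ℚ.1/ q)) qx∈V)

  module _ (w : ℝ^ n) where

    -- Induction on the family. The witness `q` counts the summands placed in the translate by `w`;
    -- it is kept as a positive rational so that `·-cancel` applies.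
    ∑-coset : ∀ {d} (v : Vector (ℝ^ n) d) →
      (∀ i → Carrier (v i) ⊎ Carrier (v i -ᵛ w)) →
      (∀ i → Carrier (v i)) ⊎
      ∃ λ q → ℚ.Positive q × Carrier (∑ᵛ v -ᵛ fromℚ q · w)
    ∑-coset {ℕ.zero} v _ = inj₁ λ ()
    ∑-coset {suc d} v v∈ with v∈ zero | ∑-coset (v ∘ suc) (v∈ ∘ suc)
    ... | inj₁ v₀∈V | inj₁ v∈V = inj₁ λ { zero → v₀∈V ; (suc i) → v∈V i }
    ... | inj₁ v₀∈V | inj₂ (q , q>0 , ∑∈) = inj₂ (q , q>0 , resp
      (λ j → ≗⇒≈ λ m → ≡.sym (ℚₚ.+-assoc (seq (v zero j) m) _ _))
      (+-closed v₀∈V ∑∈))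
    ... | inj₂ v₀∈ | inj₁ v∈V = inj₂ (1ℚ , _ , resp
      (λ j → ≗⇒≈ λ m → solve 3 (λ a b c → a :- c :+ b := a :+ b :- con 1ℚ :* c) ≡.refl
        (seq (v zero j) m) (seq (∑ᵛ (v ∘ suc) j) m) (seq (w j) m))
      (+-closed v₀∈ (∑-closed v∈V)))
    ... | inj₂ v₀∈ | inj₂ (q , q>0 , ∑∈) =
      inj₂ (1ℚ ℚ.+ q , ℚₚ.pos+pos⇒pos 1ℚ q {{q>0}} , resp
      (λ j → ≗⇒≈ λ m →
        solve 4 (λ a b c r → (a :- c) :+ (b :- r :* c) := a :+ b :- (con 1ℚ :+ r) :* c) ≡.refl
        (seq (v zero j) m) (seq (∑ᵛ (v ∘ suc) j) m) (seq (w j) m) q)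
      (+-closed v₀∈ ∑∈))

    zero-sum-members : ∀ {d} (v : Vector (ℝ^ n) d) → ∑ᵛ v ≋ 0ᵛ →
      (∀ i → Carrier (v i) ⊎ Carrier (v i -ᵛ w)) → ∀ i → Carrier (v i)
    zero-sum-members v ∑v≋0 v∈ with ∑-coset v v∈
    ... | inj₁ v∈V = v∈V
    ... | inj₂ (q , q>0 , ∑∈) = λ i → [ id , shift i ]′ (v∈ i)
      where
      instance
        q≢0 : ℚ.NonZero q
        q≢0 = ℚₚ.pos⇒nonZero q {{q>0}}

      w∈V : Carrier w
      w∈V = ·-cancel q (resp
        -- The leading zero of `0ᵛ -ᵛ (∑ᵛ v -ᵛ fromℚ q · w)` is replaced by `∑ᵛ v`; the two sums
        -- cancel and `fromℚ q · w` remains.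
        (λ j → ≈-trans (+-cong (≈-sym (∑v≋0 j)) ≈-refl) (≗⇒≈ λ m →
          solve 2 (λ a b → a :- (a :- b) := b) ≡.refl
            (seq (∑ᵛ v j) m) (q ℚ.* seq (w j) m)))
        (-ᵛ-closed 0-closed ∑∈))

      shift : ∀ i → Carrier (v i -ᵛ w) → Carrier (v i)
      shift i v-w∈V = resp
        (λ j → ≗⇒≈ λ m → solve 2 (λ a b → a :- b :+ b := a) ≡.refl
          (seq (v i j) m) (seq (w j) m))
        (+-closed v-w∈V w∈V)

  module _ {d} (x : Vector (ℝ^ n) (suc d)) (x₀≋0 : x zero ≋ 0ᵛ) (∑≋0 : ∑ᵛ (x ∘ suc) ≋ 0ᵛ) where

    private
      -- As the zero point lies in the translate by `p`, that translate is `V` itself, and the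
      -- translate by `q` is also the one by `q -ᵛ p`. The zero-sum argument applies with this
      -- difference as `w`.
      two-translates-at : ∀ p q → Carrier (x zero -ᵛ p) →
        (∀ i → Carrier (x i -ᵛ p) ⊎ Carrier (x i -ᵛ q)) → ∀ i → Carrier (x (suc i))
      two-translates-at p q x₀∈p x∈ = zero-sum-members (q -ᵛ p) (x ∘ suc) ∑≋0 λ i →
        Sum.map (same i) (other i) (x∈ (suc i))
        where
        -p∈V : Carrier (0ᵛ -ᵛ p)
        -p∈V = resp (λ j → +-cong (x₀≋0 j) ≈-refl) x₀∈p

        same : ∀ i → Carrier (x (suc i) -ᵛ p) → Carrier (x (suc i))
        same i x∈p = resp
          (λ j → ≗⇒≈ λ m → solve 2 (λ a b → a :- b :- (con 0ℚ :- b) := a) ≡.refl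
            (seq (x (suc i) j) m) (seq (p j) m))
          (-ᵛ-closed x∈p -p∈V)

        other : ∀ i → Carrier (x (suc i) -ᵛ q) → Carrier (x (suc i) -ᵛ (q -ᵛ p))
        other i x∈q = resp
          (λ j → ≗⇒≈ λ m → solve 3 (λ a b c → a :- c :- (con 0ℚ :- b) := a :- (c :- b)) ≡.refl
            (seq (x (suc i) j) m) (seq (p j) m) (seq (q j) m))
          (-ᵛ-closed x∈q -p∈V)

    two-translates : ∀ p q → (∀ i → Carrier (x i -ᵛ p) ⊎ Carrier (x i -ᵛ q)) →
      ∀ i → Carrier (x (suc i))
    -- Whichever translate holds the zero point takes the role of `p`.
    two-translates p q x∈ with x∈ zero
    ... | inj₁ x₀∈p = two-translates-at p q x₀∈p x∈
    ... | inj₂ x₀∈q = two-translates-at q p x₀∈q (Sum.swap ∘ x∈)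

-- The point set and its coordinates.

unit : ∀ {n} → Fin n → Vec ℤ n
unit i = Vec.replicate _ 0ℤ [ i ]≔ 1ℤ

lookup-unit : ∀ {n} (i : Fin n) → lookup (unit i) i ≡ 1ℤ
lookup-unit i = lookup∘update i (Vec.replicate _ 0ℤ) 1ℤ

lookup-unit′ : ∀ {n} {i j : Fin n} → i ≢ j → lookup (unit i) j ≡ 0ℤ
lookup-unit′ {j = j} i≢j = ≡.trans
  (lookup∘update′ (i≢j ∘ ≡.sym) (Vec.replicate _ 0ℤ) 1ℤ) (lookup-replicate j 0ℤ)

-- The origin comes first, so that `points ∘ suc` is the zero-sum family that `two-translates`
-- expects.
points : ∀ {n} → Fin (2 + n) → Vec ℤ n
points zero          = Vec.replicate _ 0ℤ
points (suc zero)    = Vec.replicate _ -1ℤ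
points (suc (suc i)) = unit i

-- Coordinate `j` separates `unit j` from the others: it is 1 there, and 0 or -1 elsewhere. The two
-- constant vectors differ in their first entry, which exists because the dimension is `suc m`.
points-injective : ∀ {m} {i j : Fin (3 + m)} → points {suc m} i ≡ points j → i ≡ j
points-injective {i = zero}        {zero}        _ = ≡.refl
points-injective {i = zero}        {suc zero}    ()
points-injective {i = zero}        {suc (suc j)} p =
  contradiction (≡.trans (≡.sym (lookup-replicate j 0ℤ))
    (≡.trans (cong (λ x → lookup x j) p) (lookup-unit j))) λ ()
points-injective {i = suc zero}    {zero}        ()
points-injective {i = suc zero}    {suc zero}    _ = ≡.refl
points-injective {i = suc zero}    {suc (suc j)} p =
  contradiction (≡.trans (≡.sym (lookup-replicate j -1ℤ))
    (≡.trans (cong (λ x → lookup x j) p) (lookup-unit j))) λ ()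
points-injective {i = suc (suc i)} {zero}        p =
  ≡.sym (points-injective {i = zero} {suc (suc i)} (≡.sym p))
points-injective {i = suc (suc i)} {suc zero}    p =
  ≡.sym (points-injective {i = suc zero} {suc (suc i)} (≡.sym p))
points-injective {i = suc (suc i)} {suc (suc j)} p with i ≟ j
... | yes i≡j = cong (λ k → suc (suc k)) i≡j
... | no  i≢j = contradiction
  (≡.trans (≡.sym (lookup-unit′ i≢j))
    (≡.trans (cong (λ x → lookup x j) p) (lookup-unit j))) λ ()

supNorm-≤ : ∀ {n h} (x : Vec ℤ n) → (∀ i → ℤ.∣ lookup x i ∣ ≤ h) → C n h x
supNorm-≤ []      _   = z≤n
supNorm-≤ (_ ∷ x) x≤h = ℕₚ.⊔-lub (x≤h zero) (supNorm-≤ x (x≤h ∘ suc))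

points∈C : ∀ {n} (i : Fin (2 + n)) → C n 1 (points i)
points∈C i = supNorm-≤ (points i) (bound i)
  where
  abs-≤1 : ∀ {a b} → a ≡ b → ℤ.∣ b ∣ ≤ 1 → ℤ.∣ a ∣ ≤ 1
  abs-≤1 ≡.refl b≤1 = b≤1

  bound : ∀ {n} (i : Fin (2 + n)) j → ℤ.∣ lookup (points i) j ∣ ≤ 1
  bound zero          j = abs-≤1 (lookup-replicate j 0ℤ) z≤n
  bound (suc zero)    j = abs-≤1 (lookup-replicate j -1ℤ) ℕₚ.≤-refl
  bound (suc (suc i)) j with i ≟ j
  ... | yes ≡.refl = abs-≤1 (lookup-unit i) ℕₚ.≤-refl
  ... | no  i≢j    = abs-≤1 (lookup-unit′ i≢j) z≤n

fromℤ-cong : ∀ {a b} → a ≡ b → fromℤ a ≈ fromℤ b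
fromℤ-cong ≡.refl = ≈-refl

units-standard : ∀ {n} → IsStandardBasis {n} (toℝ^ ∘ unit)
units-standard = (λ i → fromℤ-cong (lookup-unit i)) , (λ i≢j → fromℤ-cong (lookup-unit′ i≢j))

∑-standardBasis : ∀ {n} {e : Vector (ℝ^ n) n} → IsStandardBasis e → ∀ j → ∑ᵛ e j ≈ 1ℝ
∑-standardBasis {suc n} {e} (diag , off) j = begin
  ∑ᵛ e j                                      ≈⟨ sum-remove (λ i → e i j) ⟩
  e j j Reals.+ sum (λ i → e (punchIn j i) j) ≈⟨ +-cong (diag j) (sum-zero λ i → off (punchInᵢ≢i j i)) ⟩
  1ℝ Reals.+ 0ℝ                               ≈⟨ +-identityʳ 1ℝ ⟩
  1ℝ                                          ∎
  where open Relation.Binary.Reasoning.Setoid setoid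

∑-points : ∀ {n} → ∑ᵛ (toℝ^ ∘ points {n} ∘ suc) ≋ 0ᵛ
∑-points j = ≈-trans
  (+-cong (fromℤ-cong (lookup-replicate j -1ℤ)) (∑-standardBasis units-standard j))
  -- What is left is -1 + 1 in closed rationals, which computes to `0ℚ`.
  (≗⇒≈ λ _ → ≡.refl)

-- Excluding covers by at most two parallel hyperplanes.

points-uncoverable : ∀ {m} → ¬ CoveredByFewerParallelHyperplanes 3 (tabulate (points {suc m}))
-- An empty family cannot even contain the origin.
points-uncoverable (0 , _ , H , par , cover) with cover (∈-tabulate⁺ {f = points} zero)
... | () , _
points-uncoverable {m} (suc k , 1+k<3 , H , par , cover) =
  standardBasis⊈ V (Hyperplane.dimension (H zero)) units-standard
    (λ i → two-translates (toℝ^ ∘ points)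
      (λ j → fromℤ-cong (lookup-replicate j 0ℤ)) ∑-points
      -- Index `suc i` skips the point with all entries -1 and lands on `unit i`.
      (Hyperplane.point (H zero)) (proj₁ other) split (suc i))
  where
  V = Hyperplane.direction (H zero)
  open Cosets V
  open Subspace V using (Carrier)

  covered : ∀ i → ∃ λ c → Carrier (toℝ^ (points i) -ᵛ Hyperplane.point (H c))
  -- Parallelism turns membership in the direction of `H c` into membership in `V`.
  covered i = let c , x∈ = cover (∈-tabulate⁺ {f = points} i) in c , proj₂ (par zero c) x∈

  two-points : ∀ {k} (p : Vector (ℝ^ (suc m)) (suc k)) → suc k ℕ.< 3 →
    ∃ λ q → ∀ c → p c ≡ p zero ⊎ p c ≡ q
  -- A single hyperplane is treated as two equal ones.
  two-points {0} p _ = p zero , λ { zero → inj₁ ≡.refl }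
  two-points {1} p _ = p (suc zero) , λ { zero → inj₁ ≡.refl ; (suc zero) → inj₂ ≡.refl }
  two-points {suc (suc _)} p (s≤s (s≤s (s≤s ())))

  other = two-points (Hyperplane.point ∘ H) 1+k<3

  split : ∀ i → Carrier (toℝ^ (points i) -ᵛ Hyperplane.point (H zero))
              ⊎ Carrier (toℝ^ (points i) -ᵛ proj₁ other)
  split i = let c , x∈ = covered i in Sum.map (move x∈) (move x∈) (proj₂ other c)
    where
    move : ∀ {p q} → Carrier (toℝ^ (points i) -ᵛ p) → p ≡ q → Carrier (toℝ^ (points i) -ᵛ q)
    move x∈ ≡.refl = x∈

proposition2p2 : ∀ (n : ℕ) → n ≥ 1 → Σ (List (Vec ℤ n)) λ S →
    All (C n 1) S × Unique S × length S ≡ n + 2 ×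
    ¬ CoveredByFewerParallelHyperplanes 3 S
-- With `n` of the form `suc m`, the hyperplane dimension `n ∸ 1` reduces to `m`, as
-- `standardBasis⊈` requires.
proposition2p2 (suc m) _ = tabulate points
  , All.tabulate⁺ {f = points} points∈C
  , Unique.tabulate⁺ points-injective
  , ≡.trans (length-tabulate (points {suc m})) (ℕₚ.+-comm 2 (suc m))
  , points-uncoverable
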